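{- The structure $(\mathbb{N},+,\cdot,<,0,1)$ is an $\mathcal{F}$-elementary substructure of $(\mathbb{R},+,\cdot,<,0,1)$; that is, for every formula $\phi(x_1,\dots,x_m)$ in $\mathcal{F}$ with free variables among $x_1,\dots,x_m$ and all $n_1,\dots,n_m\in\mathbb{N}$, $$(\mathbb{N},+,\cdot,<,0,1)\models\phi(n_1,\dots,n_m)\quad\text{if and only if}\quad(\mathbb{R},+,\cdot,<,0,1)\models\phi(n_1,\dots,n_m).$$
   Context: Let $\mathcal{L}=\{+,\cdot,<,0,1\}$ be the language of ordered rings (first-order logic with equality), and let $\mathbb{N}=\{0,1,2,\dots\}$. Let $Q$ be a new quantifier symbol. If $\mathcal{M}=(M,<,\dots)$ is a linearly ordered $\mathcal{L}$-structure, then $\mathcal{M}\models Qx\,\phi$ is defined to mean $\mathcal{M}\models\exists z\,\forall x>z\ \phi$ (with $z$ a variable not occurring in $\phi$), i.e. "$\phi$ holds for all sufficiently large $x$"; $\phi$ may have other free variables, interpreted as parameters. $\mathcal{F}$ is the smallest collection of $\mathcal{L}$-formulas containing all quantifier-free formulas and closed under propositional connectives and under the quantifier $Q$ (i.e. if $\phi\in\mathcal{F}$ then $Qx\,\phi\in\mathcal{F}$ for each variable $x$). -}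

module Defs where

open import Algebra.Bundles.Raw using (RawSemiring)
open import Data.Fin.Base using (Fin)
open import Data.Integer.Base using (+_)
open import Data.Nat.Base as ℕ using (ℕ; zero; suc; _⊔_)
import Data.Nat.Properties as ℕₚ
open import Data.Product.Base using (Σ-syntax; _×_; _,_)
open import Data.Rational.Base as ℚ
  using (ℚ; 0ℚ; 1ℚ; ½; ∣_∣; 1/_; _/_; Positive; NonZero; NonNegative)
import Data.Rational.Properties as ℚₚ
open import Data.Rational.Solver using (module +-*-Solver)
open import Data.Sum.Base using (_⊎_)
open import Data.Vec.Base using (Vec; _∷_; lookup)
open import Function.Bundles using (_⇔_)
open import Level using (0ℓ)
open import Relation.Binary.Core using (Rel)
open import Relation.Binary.PropositionalEquality
  using (_≡_; refl; sym; cong; subst)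
open import Relation.Nullary.Negation.Core using (¬_)

------------------------------------------------------------------------
-- Syntax, with well-scoped de Bruijn variables: Term m and 𝓕 m are the
-- terms and the formulas of 𝓕 with free variables among x₀, …, xₘ₋₁.

infixl 7 _·′_
infixl 6 _+′_
infix  4 _≈′_ _<′_
infixr 3 _∧′_
infixr 2 _∨′_
infixr 1 _⇒′_ _⇔′_

data Term (m : ℕ) : Set where
  var       : Fin m → Term m
  0′ 1′     : Term m
  _+′_ _·′_ : Term m → Term m → Term m

-- The quantifier-free formulas are exactly those generated from the
-- atomic ones by the connectives, so this inductive family is the
-- smallest class containing them and closed under connectives and Q.
-- Q binds variable 0.
data 𝓕 (m : ℕ) : Set where
  _≈′_ _<′_           : Term m → Term m → 𝓕 m
  ¬′_                 : 𝓕 m → 𝓕 m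
  _∧′_ _∨′_ _⇒′_ _⇔′_ : 𝓕 m → 𝓕 m → 𝓕 m
  Q                   : 𝓕 (suc m) → 𝓕 m

------------------------------------------------------------------------
-- Semantics.  The equality symbol is interpreted by _≈_, as carriers are
-- setoids (in particular that of ℝ, whose elements are represented by
-- Cauchy sequences).

record Structure : Set₁ where
  infix 4 _<_
  field
    rawSemiring : RawSemiring 0ℓ 0ℓ
  open RawSemiring rawSemiring public
    using (Carrier; _≈_; _+_; _*_; 0#; 1#)
  field
    _<_ : Rel Carrier 0ℓ

module _ (𝓜 : Structure) where
  open Structure 𝓜

  eval : ∀ {m} → Vec Carrier m → Term m → Carrier
  eval ρ (var i)  = lookup ρ i
  eval ρ 0′       = 0#
  eval ρ 1′       = 1#
  eval ρ (s +′ t) = eval ρ s + eval ρ t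
  eval ρ (s ·′ t) = eval ρ s * eval ρ t

infix 4 _⊨_[_]

_⊨_[_] : (𝓜 : Structure) → ∀ {m} → 𝓕 m → Vec (Structure.Carrier 𝓜) m → Set
𝓜 ⊨ s ≈′ t [ ρ ] = Structure._≈_ 𝓜 (eval 𝓜 ρ s) (eval 𝓜 ρ t)
𝓜 ⊨ s <′ t [ ρ ] = Structure._<_ 𝓜 (eval 𝓜 ρ s) (eval 𝓜 ρ t)
𝓜 ⊨ ¬′ φ   [ ρ ] = ¬ (𝓜 ⊨ φ [ ρ ])
𝓜 ⊨ φ ∧′ ψ [ ρ ] = (𝓜 ⊨ φ [ ρ ]) × (𝓜 ⊨ ψ [ ρ ])
𝓜 ⊨ φ ∨′ ψ [ ρ ] = (𝓜 ⊨ φ [ ρ ]) ⊎ (𝓜 ⊨ ψ [ ρ ])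
𝓜 ⊨ φ ⇒′ ψ [ ρ ] = 𝓜 ⊨ φ [ ρ ] → 𝓜 ⊨ ψ [ ρ ]
𝓜 ⊨ φ ⇔′ ψ [ ρ ] = (𝓜 ⊨ φ [ ρ ]) ⇔ (𝓜 ⊨ ψ [ ρ ])
𝓜 ⊨ Q φ    [ ρ ] = Σ[ z ∈ Carrier ] (∀ x → z < x → 𝓜 ⊨ φ [ x ∷ ρ ])
  where open Structure 𝓜

------------------------------------------------------------------------
-- The real numbers, as Cauchy sequences of rationals modulo null
-- sequences.

IsCauchy : (ℕ → ℚ) → Set
IsCauchy x = ∀ ε → 0ℚ ℚ.< ε →
  Σ[ N ∈ ℕ ] (∀ m n → N ℕ.≤ m → N ℕ.≤ n → ∣ x m ℚ.- x n ∣ ℚ.< ε)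

record ℝ : Set where
  constructor _,ᶜ_
  field
    seq    : ℕ → ℚ
    cauchy : IsCauchy seq

open ℝ public

infix 4 _≃ᴿ_ _<ᴿ_

_≃ᴿ_ : Rel ℝ 0ℓ
x ≃ᴿ y = ∀ ε → 0ℚ ℚ.< ε →
  Σ[ N ∈ ℕ ] (∀ n → N ℕ.≤ n → ∣ seq x n ℚ.- seq y n ∣ ℚ.< ε)

-- The gap ε is essential: pointwise < is not invariant under _≃ᴿ_.
_<ᴿ_ : Rel ℝ 0ℓ
x <ᴿ y = Σ[ ε ∈ ℚ ] 0ℚ ℚ.< ε ×
  (Σ[ N ∈ ℕ ] (∀ n → N ℕ.≤ n → seq x n ℚ.+ ε ℚ.< seq y n))

abstract
  half-pos : ∀ ε → 0ℚ ℚ.< ε → 0ℚ ℚ.< ½ ℚ.* ε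
  half-pos ε ε>0 = ℚₚ.*-monoʳ-<-pos ½ ε>0

  halves : ∀ ε → ½ ℚ.* ε ℚ.+ ½ ℚ.* ε ≡ ε
  halves = solve 1 (λ e → con ½ :* e :+ con ½ :* e := e) refl
    where open +-*-Solver

  +-split : ∀ a b c d → (a ℚ.+ b) ℚ.- (c ℚ.+ d) ≡ (a ℚ.- c) ℚ.+ (b ℚ.- d)
  +-split = solve 4
    (λ a b c d → (a :+ b) :- (c :+ d) := (a :- c) :+ (b :- d)) refl
    where open +-*-Solver

  *-split : ∀ a b c d →
            (a ℚ.* b) ℚ.- (c ℚ.* d) ≡ a ℚ.* (b ℚ.- d) ℚ.+ d ℚ.* (a ℚ.- c)
  *-split = solve 4
    (λ a b c d → (a :* b) :- (c :* d) := a :* (b :- d) :+ d :* (a :- c)) refl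
    where open +-*-Solver

  constant-cauchy : ∀ q → IsCauchy (λ _ → q)
  constant-cauchy q ε ε>0 =
    0 , λ _ _ _ _ → subst (λ r → ∣ r ∣ ℚ.< ε) (sym (ℚₚ.+-inverseʳ q)) ε>0

  +-cauchy : ∀ {x y} → IsCauchy x → IsCauchy y → IsCauchy (λ n → x n ℚ.+ y n)
  +-cauchy {x} {y} cx cy ε ε>0
    with cx (½ ℚ.* ε) (half-pos ε ε>0) | cy (½ ℚ.* ε) (half-pos ε ε>0)
  ... | M , p | N , q = M ⊔ N , λ m n m≥ n≥ → begin-strict
      ∣ (x m ℚ.+ y m) ℚ.- (x n ℚ.+ y n) ∣
        ≡⟨ cong ∣_∣ (+-split (x m) (y m) (x n) (y n)) ⟩
      ∣ (x m ℚ.- x n) ℚ.+ (y m ℚ.- y n) ∣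
        ≤⟨ ℚₚ.∣p+q∣≤∣p∣+∣q∣ (x m ℚ.- x n) (y m ℚ.- y n) ⟩
      ∣ x m ℚ.- x n ∣ ℚ.+ ∣ y m ℚ.- y n ∣
        <⟨ ℚₚ.+-mono-< (p m n (ℕₚ.m⊔n≤o⇒m≤o M N m≥) (ℕₚ.m⊔n≤o⇒m≤o M N n≥))
                       (q m n (ℕₚ.m⊔n≤o⇒n≤o M N m≥) (ℕₚ.m⊔n≤o⇒n≤o M N n≥)) ⟩
      ½ ℚ.* ε ℚ.+ ½ ℚ.* ε
        ≡⟨ halves ε ⟩
      ε ∎
    where open ℚₚ.≤-Reasoning

  eventually-bounded : ∀ {x} → IsCauchy x →
    Σ[ B ∈ ℚ ] (0ℚ ℚ.< B × (Σ[ N ∈ ℕ ] (∀ n → N ℕ.≤ n → ∣ x n ∣ ℚ.< B)))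
  eventually-bounded {x} cx with cx 1ℚ (ℚₚ.positive⁻¹ 1ℚ)
  ... | N , p = 1ℚ ℚ.+ ∣ x N ∣
              , ℚₚ.+-mono-<-≤ (ℚₚ.positive⁻¹ 1ℚ) (ℚₚ.0≤∣p∣ (x N))
              , N , λ n n≥ → begin-strict
      ∣ x n ∣
        ≡⟨ cong ∣_∣ (shift (x n) (x N)) ⟩
      ∣ (x n ℚ.- x N) ℚ.+ x N ∣
        ≤⟨ ℚₚ.∣p+q∣≤∣p∣+∣q∣ (x n ℚ.- x N) (x N) ⟩
      ∣ x n ℚ.- x N ∣ ℚ.+ ∣ x N ∣
        <⟨ ℚₚ.+-monoˡ-< ∣ x N ∣ (p n N n≥ ℕₚ.≤-refl) ⟩
      1ℚ ℚ.+ ∣ x N ∣ ∎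
    where
    open ℚₚ.≤-Reasoning
    shift : ∀ a b → a ≡ (a ℚ.- b) ℚ.+ b
    shift = solve 2 (λ a b → a := (a :- b) :+ b) refl
      where open +-*-Solver

  scale : ∀ K ε → 0ℚ ℚ.< K → 0ℚ ℚ.< ε →
          Σ[ δ ∈ ℚ ] (0ℚ ℚ.< δ × K ℚ.* δ ≡ ε)
  scale K ε K>0 ε>0 = (1/ K) ℚ.* ε , δ>0 , eq
    where
    instance
      K-pos : Positive K
      K-pos = ℚ.positive K>0
      K-nonZero : NonZero K
      K-nonZero = ℚₚ.pos⇒nonZero K
      K⁻¹-pos : Positive (1/ K)
      K⁻¹-pos = ℚₚ.1/pos⇒pos K
    open ℚₚ.≤-Reasoning
    δ>0 : 0ℚ ℚ.< (1/ K) ℚ.* ε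
    δ>0 = begin-strict
      0ℚ             ≡⟨ sym (ℚₚ.*-zeroʳ (1/ K)) ⟩
      (1/ K) ℚ.* 0ℚ  <⟨ ℚₚ.*-monoʳ-<-pos (1/ K) ε>0 ⟩
      (1/ K) ℚ.* ε   ∎
    eq : K ℚ.* ((1/ K) ℚ.* ε) ≡ ε
    eq = begin-equality
      K ℚ.* ((1/ K) ℚ.* ε)  ≡⟨ sym (ℚₚ.*-assoc K (1/ K) ε) ⟩
      (K ℚ.* (1/ K)) ℚ.* ε  ≡⟨ cong (ℚ._* ε) (ℚₚ.*-inverseʳ K) ⟩
      1ℚ ℚ.* ε              ≡⟨ ℚₚ.*-identityˡ ε ⟩
      ε                     ∎

  ∣*∣-≤ : ∀ a b δ → ∣ b ∣ ℚ.< δ → ∣ a ℚ.* b ∣ ℚ.≤ ∣ a ∣ ℚ.* δ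
  ∣*∣-≤ a b δ b<δ = begin
    ∣ a ℚ.* b ∣      ≡⟨ ℚₚ.∣p*q∣≡∣p∣*∣q∣ a b ⟩
    ∣ a ∣ ℚ.* ∣ b ∣  ≤⟨ ℚₚ.*-monoˡ-≤-nonNeg ∣ a ∣ (ℚₚ.<⇒≤ b<δ) ⟩
    ∣ a ∣ ℚ.* δ      ∎
    where
    open ℚₚ.≤-Reasoning
    instance
      ∣a∣-nonNeg : NonNegative ∣ a ∣
      ∣a∣-nonNeg = ℚ.nonNegative (ℚₚ.0≤∣p∣ a)

  *-close : ∀ a b c d A B δ ε → (A ℚ.+ B) ℚ.* δ ≡ ε → 0ℚ ℚ.< δ →
            ∣ a ∣ ℚ.< A → ∣ d ∣ ℚ.< B →
            ∣ a ℚ.- c ∣ ℚ.< δ → ∣ b ℚ.- d ∣ ℚ.< δ →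
            ∣ (a ℚ.* b) ℚ.- (c ℚ.* d) ∣ ℚ.< ε
  *-close a b c d A B δ ε eq δ>0 a<A d<B a-c<δ b-d<δ = begin-strict
    ∣ (a ℚ.* b) ℚ.- (c ℚ.* d) ∣
      ≡⟨ cong ∣_∣ (*-split a b c d) ⟩
    ∣ a ℚ.* (b ℚ.- d) ℚ.+ d ℚ.* (a ℚ.- c) ∣
      ≤⟨ ℚₚ.∣p+q∣≤∣p∣+∣q∣ (a ℚ.* (b ℚ.- d)) (d ℚ.* (a ℚ.- c)) ⟩
    ∣ a ℚ.* (b ℚ.- d) ∣ ℚ.+ ∣ d ℚ.* (a ℚ.- c) ∣
      ≤⟨ ℚₚ.+-mono-≤ (∣*∣-≤ a (b ℚ.- d) δ b-d<δ) (∣*∣-≤ d (a ℚ.- c) δ a-c<δ) ⟩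
    ∣ a ∣ ℚ.* δ ℚ.+ ∣ d ∣ ℚ.* δ
      ≡⟨ sym (ℚₚ.*-distribʳ-+ δ ∣ a ∣ ∣ d ∣) ⟩
    (∣ a ∣ ℚ.+ ∣ d ∣) ℚ.* δ
      <⟨ ℚₚ.*-monoˡ-<-pos δ {{ℚ.positive δ>0}} (ℚₚ.+-mono-< a<A d<B) ⟩
    (A ℚ.+ B) ℚ.* δ
      ≡⟨ eq ⟩
    ε ∎
    where open ℚₚ.≤-Reasoning

  *-cauchy : ∀ {x y} → IsCauchy x → IsCauchy y → IsCauchy (λ n → x n ℚ.* y n)
  *-cauchy {x} {y} cx cy ε ε>0 =
    let A , A>0 , N₁ , x<A = eventually-bounded {x} cx
        B , B>0 , N₂ , y<B = eventually-bounded {y} cy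
        δ , δ>0 , eq = scale (A ℚ.+ B) ε (ℚₚ.+-mono-< A>0 B>0) ε>0
        N₃ , p = cx δ δ>0
        N₄ , q = cy δ δ>0
    in (N₁ ⊔ N₂) ⊔ (N₃ ⊔ N₄) , λ m n m≥ n≥ →
      let m₁₂ = ℕₚ.m⊔n≤o⇒m≤o (N₁ ⊔ N₂) (N₃ ⊔ N₄) m≥
          n₁₂ = ℕₚ.m⊔n≤o⇒m≤o (N₁ ⊔ N₂) (N₃ ⊔ N₄) n≥
          m₃₄ = ℕₚ.m⊔n≤o⇒n≤o (N₁ ⊔ N₂) (N₃ ⊔ N₄) m≥
          n₃₄ = ℕₚ.m⊔n≤o⇒n≤o (N₁ ⊔ N₂) (N₃ ⊔ N₄) n≥
      in *-close (x m) (y m) (x n) (y n) A B δ ε eq δ>0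
           (x<A m (ℕₚ.m⊔n≤o⇒m≤o N₁ N₂ m₁₂))
           (y<B n (ℕₚ.m⊔n≤o⇒n≤o N₁ N₂ n₁₂))
           (p m n (ℕₚ.m⊔n≤o⇒m≤o N₃ N₄ m₃₄) (ℕₚ.m⊔n≤o⇒m≤o N₃ N₄ n₃₄))
           (q m n (ℕₚ.m⊔n≤o⇒n≤o N₃ N₄ m₃₄) (ℕₚ.m⊔n≤o⇒n≤o N₃ N₄ n₃₄))

infixl 6 _+ᴿ_
infixl 7 _*ᴿ_

_+ᴿ_ _*ᴿ_ : ℝ → ℝ → ℝ
(x ,ᶜ cx) +ᴿ (y ,ᶜ cy) = (λ n → x n ℚ.+ y n) ,ᶜ +-cauchy {x} {y} cx cy
(x ,ᶜ cx) *ᴿ (y ,ᶜ cy) = (λ n → x n ℚ.* y n) ,ᶜ *-cauchy {x} {y} cx cy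

fromℚ : ℚ → ℝ
fromℚ q = (λ _ → q) ,ᶜ constant-cauchy q

fromℕ : ℕ → ℝ
fromℕ n = fromℚ (+ n / 1)

------------------------------------------------------------------------

𝓝 : Structure
𝓝 = record { rawSemiring = ℕ.+-*-rawSemiring ; _<_ = ℕ._<_ }

𝓡 : Structure
𝓡 = record
  { rawSemiring = record
      { Carrier = ℝ
      ; _≈_     = _≃ᴿ_
      ; _+_     = _+ᴿ_
      ; _*_     = _*ᴿ_
      ; 0#      = fromℚ 0ℚ
      ; 1#      = fromℚ 1ℚ
      }
  ; _<_ = _<ᴿ_
  }

{-# OPTIONS --safe #-}

-- A term of 𝓛 is a polynomial with coefficients in ℕ.  Let ρ range over
-- tuples of iteratedly large elements: x₁ beyond a bound, x₂ beyond a bound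
-- depending on x₁, and so on.  At such tuples any two polynomials compare
-- in the same way, found by comparing their coefficients lexicographically
-- from the leading one.  Hence the truth value of every formula of 𝓕 is
-- eventually constant, and an algorithm that does not depend on the
-- structure computes it.

module Submission where

open import Defs
open import Algebra.Structures using (IsCommutativeSemiring; IsCommutativeMonoid)
import Algebra.Structures.Biased as Biased
import Algebra.Properties.CommutativeSemigroup as CommutativeSemigroupProperties
import Algebra.Properties.Semiring.Mult as SemiringMult
open import Algebra.Bundles using (CommutativeSemiring)
open import Data.Bool.Base using (Bool; true; false; not; _∧_; _∨_)
open import Data.Fin.Base using (Fin; zero; suc)
open import Data.Integer.Base as ℤ using (+_)
import Data.Integer.Properties as ℤₚ
open import Data.List.Base as List using (List; []; _∷_)
open import Data.Nat.Base as ℕ using (ℕ; zero; suc; _⊔_)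
import Data.Nat.Properties as ℕₚ
open import Data.Product.Base using (Σ-syntax; _×_; _,_)
open import Data.Rational.Base as ℚ using (ℚ; 0ℚ; 1ℚ; ½; ∣_∣)
import Data.Rational.Properties as ℚₚ
import Data.Rational.Unnormalised.Base as ℚᵘ
import Data.Rational.Unnormalised.Properties as ℚᵘₚ
open import Data.Rational.Solver using (module +-*-Solver)
open import Data.Sum.Base using (_⊎_; inj₁; inj₂)
open import Data.Vec.Base using (Vec; []; _∷_; _++_; lookup; map)
open import Data.Vec.Properties using (lookup-map)
open import Function.Base using (id)
open import Function.Bundles using (_⇔_; mk⇔; Equivalence)
open import Level using (0ℓ)
open import Relation.Binary.PropositionalEquality
  using (_≡_; refl; sym; trans; cong; subst)
open import Relation.Binary.Structures using (IsEquivalence; IsStrictPartialOrder)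
open import Relation.Nullary.Decidable using (toWitness)
open import Relation.Nullary.Negation.Core using (¬_; contradiction)
open import Relation.Nullary.Reflects
  using (Reflects; ofʸ; ofⁿ; ¬-reflects; _×-reflects_; _⊎-reflects_; _→-reflects_)

-- Polynomials and the decision procedure

-- The head of a coefficient list is the constant coefficient; the main
-- variable is the innermost one, that is, variable 0.
Poly : ℕ → Set
Poly zero    = ℕ
Poly (suc k) = List (Poly k)

constant : ∀ k → ℕ → Poly k
constant zero    n = n
constant (suc k) n = constant k n ∷ []

add : ∀ k → Poly k → Poly k → Poly k
add zero    m       n       = m ℕ.+ n
add (suc k) []      q       = q
add (suc k) (a ∷ p) []      = a ∷ p
add (suc k) (a ∷ p) (b ∷ q) = add k a b ∷ add (suc k) p q

mul : ∀ k → Poly k → Poly k → Poly k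
mul zero    m       n = m ℕ.* n
mul (suc k) []      q = []
mul (suc k) (a ∷ p) q =
  -- Expands (a + x p) q = a q + x (p q); the prepended 0 multiplies by x.
  add (suc k) (List.map (mul k a) q) (constant k 0 ∷ mul (suc k) p q)

-- Only the k variables bound by `Q` become indeterminates. The parameters `ns` enter as constants,
-- so all coefficients are ultimately natural numbers, which both structures share.
variable′ : ∀ k {m} → Vec ℕ m → Fin (k ℕ.+ m) → Poly k
variable′ zero    ns i       = lookup ns i
variable′ (suc k) ns zero    = constant k 0 ∷ constant k 1 ∷ []
variable′ (suc k) ns (suc i) = variable′ k ns i ∷ []

poly : ∀ k {m} → Vec ℕ m → Term (k ℕ.+ m) → Poly k
poly k ns (var i)  = variable′ k ns i
poly k ns 0′       = constant k 0
poly k ns 1′       = constant k 1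
poly k ns (s +′ t) = add k (poly k ns s) (poly k ns t)
poly k ns (s ·′ t) = mul k (poly k ns s) (poly k ns t)

data Comparison : Set where
  lt eq gt : Comparison

isEq isLt : Comparison → Bool
isEq lt = false
isEq eq = true
isEq gt = false
isLt lt = true
isLt eq = false
isLt gt = false

infixr 4 _then_

_then_ : Comparison → Comparison → Comparison
lt then _ = lt
eq then o = o
gt then _ = gt

compareℕ : ℕ → ℕ → Comparison
compareℕ zero    zero    = eq
compareℕ zero    (suc n) = lt
compareℕ (suc m) zero    = gt
compareℕ (suc m) (suc n) = compareℕ m n

-- Higher powers outweigh lower ones, so tails are compared before heads. Leading coefficients may
-- vanish, so lists of different lengths can have equal values; the shorter one is padded with 0.
compare : ∀ k → Poly k → Poly k → Comparison
compare zero    m       n       = compareℕ m n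
compare (suc k) []      []      = eq
compare (suc k) []      (b ∷ q) = compare (suc k) [] q then compare k (constant k 0) b
compare (suc k) (a ∷ p) []      = compare (suc k) p [] then compare k a (constant k 0)
compare (suc k) (a ∷ p) (b ∷ q) = compare (suc k) p q then compare k a b

decide : ∀ k {m} → Vec ℕ m → 𝓕 (k ℕ.+ m) → Bool
decide k ns (s ≈′ t)  = isEq (compare k (poly k ns s) (poly k ns t))
decide k ns (s <′ t)  = isLt (compare k (poly k ns s) (poly k ns t))
decide k ns (¬′ φ)    = not (decide k ns φ)
decide k ns (φ ∧′ ψ)  = decide k ns φ ∧ decide k ns ψ
decide k ns (φ ∨′ ψ)  = decide k ns φ ∨ decide k ns ψ
decide k ns (φ ⇒′ ψ)  = not (decide k ns φ) ∨ decide k ns ψ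
decide k ns (φ ⇔′ ψ)  =
  (not (decide k ns φ) ∨ decide k ns ψ) ∧ (not (decide k ns ψ) ∨ decide k ns φ)
-- No bound is searched for: the quantified variable becomes one more indeterminate, larger than all
-- earlier ones.
decide k ns (Q φ)     = decide (suc k) ns φ

⇔-reflects : ∀ {A B : Set} {a b} → Reflects A a → Reflects B b →
             Reflects (A ⇔ B) ((not a ∨ b) ∧ (not b ∨ a))
⇔-reflects {A} {B} r s = convert ((r →-reflects s) ×-reflects (s →-reflects r))
  where
  convert : ∀ {b} → Reflects ((A → B) × (B → A)) b → Reflects (A ⇔ B) b
  convert (ofʸ (f , g)) = ofʸ (mk⇔ f g)
  convert (ofⁿ ¬fg)     = ofⁿ λ e → ¬fg (Equivalence.to e , Equivalence.from e)

-- Correctness over an ordered semiring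

-- A positive polynomial in a large x over ℝ must be kept away from 0
-- uniformly in x for the induction on its degree to go through; the element
-- gap does this.  It is 0 in ℕ and ½ in ℝ.
record Axioms (𝓜 : Structure) : Set₁ where
  open Structure 𝓜
  field
    isCommutativeSemiring : IsCommutativeSemiring _≈_ _+_ _*_ 0# 1#
    isStrictPartialOrder  : IsStrictPartialOrder _≈_ _<_
    +-monoˡ-<             : ∀ {a b} c → a < b → a + c < b + c
    directed              : ∀ a b → Σ[ c ∈ Carrier ] (a < c × b < c)
    gap                   : Carrier
    gap<1                 : gap < 1#
    gap-<                 : ∀ {a b} → gap + a < b → a < b
    dominates             : ∀ a b → Σ[ z ∈ Carrier ] (∀ x → z < x →
                              ∀ p q → gap + p < q → gap + (a + x * p) < b + x * q)

module Correctness {𝓜 : Structure} (axioms : Axioms 𝓜) where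
  open Structure 𝓜
  open Axioms axioms

  commutativeSemiring : CommutativeSemiring 0ℓ 0ℓ
  commutativeSemiring = record { isCommutativeSemiring = isCommutativeSemiring }

  open CommutativeSemiring commutativeSemiring
    using (setoid; semiring; +-commutativeSemigroup; *-commutativeSemigroup;
           +-cong; +-congˡ; +-congʳ; *-cong; *-congˡ; +-assoc; +-comm; *-assoc;
           +-identityˡ; +-identityʳ; *-identityʳ; distribˡ; distribʳ; zeroˡ; zeroʳ)
    renaming (refl to ≈-refl; sym to ≈-sym; trans to ≈-trans)
  open CommutativeSemigroupProperties +-commutativeSemigroup using (interchange)
  open CommutativeSemigroupProperties *-commutativeSemigroup using ()
    renaming (x∙yz≈y∙xz to x*yz≈y*xz)
  open SemiringMult semiring using (×-homo-+; ×1-homo-*) renaming (_×_ to _·_)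
  open IsStrictPartialOrder isStrictPartialOrder
    using (irrefl; asym; <-respʳ-≈; <-respˡ-≈) renaming (trans to <-trans)
  open import Relation.Binary.Reasoning.Setoid setoid

  numeral : ℕ → Carrier
  numeral n = n · 1#

  -- Eventual and generic truth

  Eventually : (Carrier → Set) → Set
  Eventually P = Σ[ z ∈ Carrier ] (∀ x → z < x → P x)

  always : ∀ {P : Carrier → Set} → (∀ x → P x) → Eventually P
  always p = 0# , λ x _ → p x

  eventually-map : ∀ {P R : Carrier → Set} →
                   (∀ x → P x → R x) → Eventually P → Eventually R
  eventually-map f (z , p) = z , λ x z<x → f x (p x z<x)

  eventually-zip : ∀ {P R S : Carrier → Set} →
                   (∀ x → P x → R x → S x) → Eventually P → Eventually R → Eventually S
  eventually-zip f (y , p) (z , r) with directed y z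
  ... | w , y<w , z<w = w , λ x w<x →
    f x (p x (<-trans y<w w<x)) (r x (<-trans z<w w<x))

  eventually⇒inhabited : ∀ {P : Carrier → Set} → Eventually P → Σ[ x ∈ Carrier ] P x
  -- Pairing z with itself turns directedness into the absence of a largest element.
  eventually⇒inhabited (z , p) with directed z z
  ... | x , z<x , _ = x , p x z<x

  -- The tail of the tuple is chosen first, so the bound for the head may depend on it; variable 0,
  -- bound innermost, grows fastest. At k = 0 this is plain truth.
  Generically : ∀ k → (Vec Carrier k → Set) → Set
  Generically zero    P = P []
  Generically (suc k) P = Generically k λ ρ → Eventually λ x → P (x ∷ ρ)

  generically-map : ∀ k {P R : Vec Carrier k → Set} →
                    (∀ ρ → P ρ → R ρ) → Generically k P → Generically k R
  generically-map zero    f = f []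
  generically-map (suc k) f =
    generically-map k λ ρ → eventually-map λ x → f (x ∷ ρ)

  generically-zip : ∀ k {P R S : Vec Carrier k → Set} → (∀ ρ → P ρ → R ρ → S ρ) →
                    Generically k P → Generically k R → Generically k S
  generically-zip zero    f = f []
  generically-zip (suc k) f =
    generically-zip k λ ρ → eventually-zip λ x → f (x ∷ ρ)

  generically-always : ∀ k {P : Vec Carrier k → Set} → (∀ ρ → P ρ) → Generically k P
  generically-always zero    p = p []
  generically-always (suc k) p = generically-always k λ ρ → always λ x → p (x ∷ ρ)

  -- Values of polynomials

  ⟦_⟧ : ∀ {k} → Poly k → Vec Carrier k → Carrier
  ⟦_⟧ {zero}  n       []      = numeral n
  ⟦_⟧ {suc k} []      (x ∷ ρ) = 0#
  ⟦_⟧ {suc k} (a ∷ p) (x ∷ ρ) = ⟦ a ⟧ ρ + x * ⟦_⟧ {suc k} p (x ∷ ρ)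

  a+x*0≈a : ∀ a x → a + x * 0# ≈ a
  a+x*0≈a a x = ≈-trans (+-congˡ (zeroʳ x)) (+-identityʳ a)

  ⟦constant⟧ : ∀ k n ρ → ⟦ constant k n ⟧ ρ ≈ numeral n
  ⟦constant⟧ zero    n []      = ≈-refl
  ⟦constant⟧ (suc k) n (x ∷ ρ) = ≈-trans (a+x*0≈a _ x) (⟦constant⟧ k n ρ)

  ⟦add⟧ : ∀ k p q ρ → ⟦ add k p q ⟧ ρ ≈ ⟦ p ⟧ ρ + ⟦ q ⟧ ρ
  ⟦add⟧ zero    m       n       []      = ×-homo-+ 1# m n
  ⟦add⟧ (suc k) []      q       (x ∷ ρ) = ≈-sym (+-identityˡ _)
  ⟦add⟧ (suc k) (a ∷ p) []      (x ∷ ρ) = ≈-sym (+-identityʳ _)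
  ⟦add⟧ (suc k) (a ∷ p) (b ∷ q) (x ∷ ρ) = begin
    ⟦ add k a b ⟧ ρ + x * ⟦ add (suc k) p q ⟧ (x ∷ ρ)
      ≈⟨ +-cong (⟦add⟧ k a b ρ) (*-congˡ (⟦add⟧ (suc k) p q (x ∷ ρ))) ⟩
    (A + B) + x * (P + R)
      ≈⟨ +-congˡ (distribˡ x P R) ⟩
    (A + B) + (x * P + x * R)
      ≈⟨ interchange A B (x * P) (x * R) ⟩
    (A + x * P) + (B + x * R) ∎
    where
    A = ⟦ a ⟧ ρ
    B = ⟦ b ⟧ ρ
    P = ⟦_⟧ {suc k} p (x ∷ ρ)
    R = ⟦_⟧ {suc k} q (x ∷ ρ)

  mutual
    ⟦mul⟧ : ∀ k p q ρ → ⟦ mul k p q ⟧ ρ ≈ ⟦ p ⟧ ρ * ⟦ q ⟧ ρ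
    ⟦mul⟧ zero    m       n []      = ×1-homo-* m n
    ⟦mul⟧ (suc k) []      q (x ∷ ρ) = ≈-sym (zeroˡ _)
    ⟦mul⟧ (suc k) (a ∷ p) q (x ∷ ρ) = begin
      ⟦ mul (suc k) (a ∷ p) q ⟧ (x ∷ ρ)
        ≈⟨ ⟦add⟧ (suc k) (List.map (mul k a) q) (constant k 0 ∷ mul (suc k) p q) (x ∷ ρ) ⟩
      ⟦_⟧ {suc k} (List.map (mul k a) q) (x ∷ ρ) +
        (⟦ constant k 0 ⟧ ρ + x * ⟦ mul (suc k) p q ⟧ (x ∷ ρ))
        ≈⟨ +-cong (⟦scale⟧ k a q x ρ)
                  (+-cong (⟦constant⟧ k 0 ρ) (*-congˡ (⟦mul⟧ (suc k) p q (x ∷ ρ)))) ⟩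
      A * R + (0# + x * (P * R))
        ≈⟨ +-congˡ (≈-trans (+-identityˡ _) (≈-sym (*-assoc x P R))) ⟩
      A * R + (x * P) * R
        ≈⟨ distribʳ R A (x * P) ⟨
      (A + x * P) * R ∎
      where
      A = ⟦ a ⟧ ρ
      P = ⟦_⟧ {suc k} p (x ∷ ρ)
      R = ⟦_⟧ {suc k} q (x ∷ ρ)

    ⟦scale⟧ : ∀ k a q x ρ → ⟦_⟧ {suc k} (List.map (mul k a) q) (x ∷ ρ) ≈
                            ⟦ a ⟧ ρ * ⟦_⟧ {suc k} q (x ∷ ρ)
    ⟦scale⟧ k a []      x ρ = ≈-sym (zeroʳ _)
    ⟦scale⟧ k a (b ∷ q) x ρ = begin
      ⟦ mul k a b ⟧ ρ + x * ⟦_⟧ {suc k} (List.map (mul k a) q) (x ∷ ρ)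
        ≈⟨ +-cong (⟦mul⟧ k a b ρ) (*-congˡ (⟦scale⟧ k a q x ρ)) ⟩
      A * B + x * (A * R)
        ≈⟨ +-congˡ (x*yz≈y*xz x A R) ⟩
      A * B + A * (x * R)
        ≈⟨ distribˡ A B (x * R) ⟨
      A * (B + x * R) ∎
      where
      A = ⟦ a ⟧ ρ
      B = ⟦ b ⟧ ρ
      R = ⟦_⟧ {suc k} q (x ∷ ρ)

  -- lt and gt record a separation by more than gap.
  Compares : Comparison → Carrier → Carrier → Set
  Compares lt a b = gap + a < b
  Compares eq a b = a ≈ b
  Compares gt a b = gap + b < a

  compares-resp : ∀ o {a a′ b b′} → a ≈ a′ → b ≈ b′ → Compares o a b → Compares o a′ b′
  compares-resp lt a≈a′ b≈b′ a<b = <-respʳ-≈ b≈b′ (<-respˡ-≈ (+-congˡ a≈a′) a<b)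
  compares-resp eq a≈a′ b≈b′ a≈b = ≈-trans (≈-sym a≈a′) (≈-trans a≈b b≈b′)
  compares-resp gt a≈a′ b≈b′ b<a = <-respʳ-≈ a≈a′ (<-respˡ-≈ (+-congˡ b≈b′) b<a)

  gap-mono : ∀ {a b} c → gap + a < b → gap + (a + c) < b + c
  gap-mono {a} c a<b = <-respˡ-≈ (+-assoc gap a c) (+-monoˡ-< c a<b)

  compares-+ʳ : ∀ o {a b} c → Compares o a b → Compares o (a + c) (b + c)
  compares-+ʳ lt c a<b = gap-mono c a<b
  compares-+ʳ eq c a≈b = +-congʳ a≈b
  compares-+ʳ gt c b<a = gap-mono c b<a

  -- The bound on x comes from a and b alone, so p and q may be values that themselves depend on x.
  -- If p and q are separated, `dominates` makes the constant terms irrelevant; if they agree, a and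
  -- b decide.
  compares-horner : ∀ o′ a b → Compares o′ a b → Eventually λ x →
    ∀ o p q → Compares o p q → Compares (o then o′) (a + x * p) (b + x * q)
  compares-horner o′ a b a?b = eventually-zip
    (λ { x l g lt p q p<q → l p q p<q
       ; x l g eq p q p≈q → compares-resp o′ ≈-refl (+-congˡ (*-congˡ p≈q))
                                          (compares-+ʳ o′ (x * p) a?b)
       ; x l g gt p q q<p → g q p q<p })
    (dominates a b) (dominates b a)

  a<1+a : ∀ a → a < 1# + a
  a<1+a a = gap-< (+-monoˡ-< a gap<1)

  gap<numeral : ∀ n → gap < numeral (suc n)
  gap<numeral zero    = <-respʳ-≈ (≈-sym (+-identityʳ 1#)) gap<1
  gap<numeral (suc n) = <-trans (gap<numeral n) (a<1+a _)

  -- Distinct numerals lie at least 1 apart, which is more than `gap`. The induction cancels a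
  -- common summand 1.
  compareℕ-correct : ∀ m n → Compares (compareℕ m n) (numeral m) (numeral n)
  compareℕ-correct zero    zero    = ≈-refl
  compareℕ-correct zero    (suc n) = <-respˡ-≈ (≈-sym (+-identityʳ gap)) (gap<numeral n)
  compareℕ-correct (suc m) zero    = <-respˡ-≈ (≈-sym (+-identityʳ gap)) (gap<numeral m)
  compareℕ-correct (suc m) (suc n) =
    compares-resp (compareℕ m n) (+-comm _ 1#) (+-comm _ 1#)
      (compares-+ʳ (compareℕ m n) 1# (compareℕ-correct m n))

  ⟦0⟧-horner : ∀ k x ρ → ⟦ constant k 0 ⟧ ρ + x * 0# ≈ 0#
  ⟦0⟧-horner k x ρ = ≈-trans (a+x*0≈a _ x) (⟦constant⟧ k 0 ρ)

  -- The heads are compared at ρ, before x is chosen, and so can supply a bound on x; beyond it the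
  -- comparison of the tails at that same x takes precedence.
  horner-correct : ∀ k a p b q →
    Generically (suc k) (λ ρ → Compares (compare (suc k) p q) (⟦_⟧ {suc k} p ρ) (⟦_⟧ {suc k} q ρ)) →
    Generically k (λ ρ → Compares (compare k a b) (⟦ a ⟧ ρ) (⟦ b ⟧ ρ)) →
    Generically (suc k) λ ρ → Compares (compare (suc k) p q then compare k a b)
                                       (⟦_⟧ {suc k} (a ∷ p) ρ) (⟦_⟧ {suc k} (b ∷ q) ρ)
  horner-correct k a p b q = generically-zip k λ ρ p?q a?b →
    eventually-zip (λ x p?q h → h (compare (suc k) p q) _ _ p?q) p?q
      (compares-horner (compare k a b) _ _ a?b)

  compare-correct : ∀ k p q →
    Generically k λ ρ → Compares (compare k p q) (⟦ p ⟧ ρ) (⟦ q ⟧ ρ)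
  compare-correct zero    m       n       = compareℕ-correct m n
  compare-correct (suc k) []      []      = generically-always k λ ρ → always λ x → ≈-refl
  -- The empty list is traded for the list with the single coefficient 0, which has the same value,
  -- so that both sides have a head.
  compare-correct (suc k) []      (b ∷ q) =
    generically-map k
      (λ ρ → eventually-map λ x →
        compares-resp (compare (suc k) [] (b ∷ q)) (⟦0⟧-horner k x ρ) ≈-refl)
      (horner-correct k (constant k 0) [] b q
        (compare-correct (suc k) [] q) (compare-correct k (constant k 0) b))
  compare-correct (suc k) (a ∷ p) []      =
    generically-map k
      (λ ρ → eventually-map λ x →
        compares-resp (compare (suc k) (a ∷ p) []) ≈-refl (⟦0⟧-horner k x ρ))
      (horner-correct k a p (constant k 0) []
        (compare-correct (suc k) p []) (compare-correct k a (constant k 0)))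
  compare-correct (suc k) (a ∷ p) (b ∷ q) =
    horner-correct k a p b q (compare-correct (suc k) p q) (compare-correct k a b)

  -- From comparisons to the truth of formulas

  isEq-reflects : ∀ o {a b} → Compares o a b → Reflects (a ≈ b) (isEq o)
  isEq-reflects lt a<b = ofⁿ λ a≈b → irrefl a≈b (gap-< a<b)
  isEq-reflects eq a≈b = ofʸ a≈b
  isEq-reflects gt b<a = ofⁿ λ a≈b → irrefl (≈-sym a≈b) (gap-< b<a)

  isLt-reflects : ∀ o {a b} → Compares o a b → Reflects (a < b) (isLt o)
  isLt-reflects lt a<b = ofʸ (gap-< a<b)
  isLt-reflects eq a≈b = ofⁿ (irrefl a≈b)
  isLt-reflects gt b<a = ofⁿ (asym (gap-< b<a))

  module _ {m} (ns : Vec ℕ m) (σ : Vec Carrier m)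
           (numerals : ∀ i → lookup σ i ≈ numeral (lookup ns i)) where

    ⟦variable⟧ : ∀ k i (ρ : Vec Carrier k) →
                 lookup (ρ ++ σ) i ≈ ⟦ variable′ k ns i ⟧ ρ
    ⟦variable⟧ zero    i       []      = numerals i
    ⟦variable⟧ (suc k) zero    (x ∷ ρ) = ≈-sym (begin
      ⟦ constant k 0 ⟧ ρ + x * (⟦ constant k 1 ⟧ ρ + x * 0#)
        ≈⟨ +-cong (⟦constant⟧ k 0 ρ)
             (*-congˡ (≈-trans (a+x*0≈a _ x) (⟦constant⟧ k 1 ρ))) ⟩
      0# + x * (1# + 0#)  ≈⟨ +-identityˡ _ ⟩
      x * (1# + 0#)       ≈⟨ *-congˡ (+-identityʳ 1#) ⟩
      x * 1#              ≈⟨ *-identityʳ x ⟩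
      x                   ∎)
    ⟦variable⟧ (suc k) (suc i) (x ∷ ρ) =
      ≈-trans (⟦variable⟧ k i ρ) (≈-sym (a+x*0≈a _ x))

    ⟦poly⟧ : ∀ k t (ρ : Vec Carrier k) → eval 𝓜 (ρ ++ σ) t ≈ ⟦ poly k ns t ⟧ ρ
    ⟦poly⟧ k (var i)  ρ = ⟦variable⟧ k i ρ
    ⟦poly⟧ k 0′       ρ = ≈-sym (⟦constant⟧ k 0 ρ)
    ⟦poly⟧ k 1′       ρ = ≈-sym (≈-trans (⟦constant⟧ k 1 ρ) (+-identityʳ 1#))
    ⟦poly⟧ k (s +′ t) ρ =
      ≈-trans (+-cong (⟦poly⟧ k s ρ) (⟦poly⟧ k t ρ)) (≈-sym (⟦add⟧ k _ _ ρ))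
    ⟦poly⟧ k (s ·′ t) ρ =
      ≈-trans (*-cong (⟦poly⟧ k s ρ) (⟦poly⟧ k t ρ)) (≈-sym (⟦mul⟧ k (poly k ns s) (poly k ns t) ρ))

    terms-compare : ∀ k s t → Generically k λ ρ →
      Compares (compare k (poly k ns s) (poly k ns t))
               (eval 𝓜 (ρ ++ σ) s) (eval 𝓜 (ρ ++ σ) t)
    terms-compare k s t = generically-map k
      (λ ρ → compares-resp (compare k (poly k ns s) (poly k ns t))
               (≈-sym (⟦poly⟧ k s ρ)) (≈-sym (⟦poly⟧ k t ρ)))
      (compare-correct k _ _)

    -- Two eventual conditions hold together at some element, so a property that eventually fails
    -- cannot eventually hold. Without a constant truth value b, the failure of `Eventually P` would
    -- not follow from failures at single elements.
    eventually-reflects : ∀ b {P : Carrier → Set} →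
      Eventually (λ x → Reflects (P x) b) → Reflects (Eventually P) b
    eventually-reflects true  r = ofʸ (eventually-map (λ { _ (ofʸ p) → p }) r)
    eventually-reflects false r = ofⁿ λ p →
      impossible (eventually⇒inhabited (eventually-zip (λ x → _,_) r p))
      where
      impossible : ∀ {P : Carrier → Set} → ¬ (Σ[ x ∈ Carrier ] (Reflects (P x) false × P x))
      impossible (x , ofⁿ ¬p , p) = ¬p p

    -- `Reflects` carries a proof or a refutation, so the induction passes constructively through
    -- all connectives, although the order of ℝ is not decidable in general.
    decide-correct : ∀ k (φ : 𝓕 (k ℕ.+ m)) →
      Generically k λ ρ → Reflects (𝓜 ⊨ φ [ ρ ++ σ ]) (decide k ns φ)
    decide-correct k (s ≈′ t)  = generically-map k (λ ρ → isEq-reflects _) (terms-compare k s t)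
    decide-correct k (s <′ t)  = generically-map k (λ ρ → isLt-reflects _) (terms-compare k s t)
    decide-correct k (¬′ φ)    = generically-map k (λ ρ → ¬-reflects) (decide-correct k φ)
    decide-correct k (φ ∧′ ψ)  =
      generically-zip k (λ ρ → _×-reflects_) (decide-correct k φ) (decide-correct k ψ)
    decide-correct k (φ ∨′ ψ)  =
      generically-zip k (λ ρ → _⊎-reflects_) (decide-correct k φ) (decide-correct k ψ)
    decide-correct k (φ ⇒′ ψ)  =
      generically-zip k (λ ρ → _→-reflects_) (decide-correct k φ) (decide-correct k ψ)
    decide-correct k (φ ⇔′ ψ)  =
      generically-zip k (λ ρ → ⇔-reflects) (decide-correct k φ) (decide-correct k ψ)
    -- Genericity for `suc k` unfolds to genericity for k of an `Eventually`, and `Eventually` is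
    -- literally the semantics of `Q`.
    decide-correct k (Q φ)     =
      generically-map k (λ ρ → eventually-reflects _) (decide-correct (suc k) φ)

-- The natural numbers

𝓝-axioms : Axioms 𝓝
𝓝-axioms = record
  { isCommutativeSemiring = ℕₚ.+-*-isCommutativeSemiring
  ; isStrictPartialOrder  = ℕₚ.<-isStrictPartialOrder
  ; +-monoˡ-<             = λ c → ℕₚ.+-monoˡ-< c
  ; directed              = λ a b → suc (a ⊔ b) , ℕ.s≤s (ℕₚ.m≤m⊔n a b) , ℕ.s≤s (ℕₚ.m≤n⊔m a b)
  ; gap                   = 0
  ; gap<1                 = ℕ.s≤s ℕ.z≤n
  ; gap-<                 = id
  -- By discreteness q is at least p + 1, so a single extra x, being larger than a, absorbs the
  -- constant term.
  ; dominates             = λ a b → a , λ x a<x p q p<q → begin-strict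
      a ℕ.+ x ℕ.* p  <⟨ ℕₚ.+-monoˡ-< (x ℕ.* p) a<x ⟩
      x ℕ.+ x ℕ.* p  ≡⟨ ℕₚ.*-suc x p ⟨
      x ℕ.* suc p    ≤⟨ ℕₚ.*-monoʳ-≤ x p<q ⟩
      x ℕ.* q        ≤⟨ ℕₚ.m≤n+m (x ℕ.* q) b ⟩
      b ℕ.+ x ℕ.* q  ∎
  }
  where open ℕₚ.≤-Reasoning

-- The real numbers

Eventuallyℕ : (ℕ → Set) → Set
Eventuallyℕ P = Σ[ N ∈ ℕ ] (∀ n → N ℕ.≤ n → P n)

infixl 4 _⊛_

_⊛_ : ∀ {P R : ℕ → Set} → Eventuallyℕ (λ n → P n → R n) → Eventuallyℕ P → Eventuallyℕ R
(M , f) ⊛ (N , p) = M ⊔ N , λ n n≥ →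
  f n (ℕₚ.m⊔n≤o⇒m≤o M N n≥) (p n (ℕₚ.m⊔n≤o⇒n≤o M N n≥))

pureℕ : ∀ {P : ℕ → Set} → (∀ n → P n) → Eventuallyℕ P
pureℕ p = 0 , λ n _ → p n

-- Inequalities between rationals

p≤∣p∣ : ∀ p → p ℚ.≤ ∣ p ∣
p≤∣p∣ p with ℚₚ.≤-total 0ℚ p
... | inj₁ 0≤p = ℚₚ.≤-reflexive (sym (ℚₚ.0≤p⇒∣p∣≡p 0≤p))
... | inj₂ p≤0 = ℚₚ.≤-trans p≤0 (ℚₚ.0≤∣p∣ p)

∣p-q∣≡∣q-p∣ : ∀ p q → ∣ p ℚ.- q ∣ ≡ ∣ q ℚ.- p ∣
∣p-q∣≡∣q-p∣ p q = trans (sym (ℚₚ.∣-p∣≡∣p∣ (p ℚ.- q)))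
  (cong ∣_∣ (solve 2 (λ p q → :- (p :- q) := q :- p) refl p q))
  where open +-*-Solver

∣p-q∣<ε⇒p<q+ε : ∀ p q ε → ∣ p ℚ.- q ∣ ℚ.< ε → p ℚ.< q ℚ.+ ε
∣p-q∣<ε⇒p<q+ε p q ε h = begin-strict
  p               ≡⟨ solve 2 (λ p q → p := q :+ (p :- q)) refl p q ⟩
  q ℚ.+ (p ℚ.- q) <⟨ ℚₚ.+-monoʳ-< q (ℚₚ.≤-<-trans (p≤∣p∣ (p ℚ.- q)) h) ⟩
  q ℚ.+ ε         ∎
  where
  open ℚₚ.≤-Reasoning
  open +-*-Solver

∣p∣<ε⇒0<ε+p : ∀ p ε → ∣ p ∣ ℚ.< ε → 0ℚ ℚ.< ε ℚ.+ p
∣p∣<ε⇒0<ε+p p ε h = begin-strict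
  0ℚ            ≡⟨ ℚₚ.+-inverseˡ p ⟨
  ℚ.- p ℚ.+ p   <⟨ ℚₚ.+-monoˡ-< p (ℚₚ.≤-<-trans (p≤∣p∣ (ℚ.- p))
                     (subst (ℚ._< ε) (sym (ℚₚ.∣-p∣≡∣p∣ p)) h)) ⟩
  ε ℚ.+ p       ∎
  where open ℚₚ.≤-Reasoning

-- Half of the separation ε pays for replacing b by the nearby c; the other half remains as the new
-- separation.
<-halve : ∀ a b c ε → a ℚ.+ ε ℚ.< b → b ℚ.< c ℚ.+ ½ ℚ.* ε → a ℚ.+ ½ ℚ.* ε ℚ.< c
<-halve a b c ε a+ε<b b<c+ε/2 = begin-strict
  a ℚ.+ ½ ℚ.* ε                        ≡⟨ shift a ε ⟩
  (a ℚ.+ ε) ℚ.- ½ ℚ.* ε                <⟨ ℚₚ.+-monoˡ-< (ℚ.- (½ ℚ.* ε)) (ℚₚ.<-trans a+ε<b b<c+ε/2) ⟩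
  (c ℚ.+ ½ ℚ.* ε) ℚ.- ½ ℚ.* ε          ≡⟨ cancel c ε ⟩
  c                                    ∎
  where
  open ℚₚ.≤-Reasoning
  open +-*-Solver
  shift : ∀ a ε → a ℚ.+ ½ ℚ.* ε ≡ (a ℚ.+ ε) ℚ.- ½ ℚ.* ε
  shift = solve 2 (λ a e → a :+ con ½ :* e := (a :+ e) :- con ½ :* e) refl
  cancel : ∀ c ε → (c ℚ.+ ½ ℚ.* ε) ℚ.- ½ ℚ.* ε ≡ c
  cancel = solve 2 (λ c e → (c :+ con ½ :* e) :- con ½ :* e := c) refl

-- Equality and arithmetic of real numbers

pointwise : ∀ {x y} → (∀ n → seq x n ≡ seq y n) → x ≃ᴿ y
pointwise {x} {y} x≡y ε ε>0 = pureℕ λ n →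
  subst (λ q → ∣ seq x n ℚ.- q ∣ ℚ.< ε) (x≡y n)
    (subst (λ d → ∣ d ∣ ℚ.< ε) (sym (ℚₚ.+-inverseʳ (seq x n))) ε>0)

≃ᴿ-isEquivalence : IsEquivalence _≃ᴿ_
≃ᴿ-isEquivalence = record
  { refl  = λ {x} → pointwise {x} {x} λ n → refl
  ; sym   = λ {x} {y} x≃y ε ε>0 →
      pureℕ (λ n → subst (ℚ._< ε) (∣p-q∣≡∣q-p∣ (seq x n) (seq y n))) ⊛ x≃y ε ε>0
  ; trans = λ {x} {y} {z} x≃y y≃z ε ε>0 →
      pureℕ (λ n → triangle (seq x n) (seq y n) (seq z n) ε)
        ⊛ x≃y (½ ℚ.* ε) (half-pos ε ε>0) ⊛ y≃z (½ ℚ.* ε) (half-pos ε ε>0)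
  }
  where
  open ℚₚ.≤-Reasoning
  triangle : ∀ p q r ε → ∣ p ℚ.- q ∣ ℚ.< ½ ℚ.* ε → ∣ q ℚ.- r ∣ ℚ.< ½ ℚ.* ε → ∣ p ℚ.- r ∣ ℚ.< ε
  triangle p q r ε h k = begin-strict
    ∣ p ℚ.- r ∣
      ≡⟨ cong ∣_∣ (solve 3 (λ p q r → p :- r := (p :- q) :+ (q :- r)) refl p q r) ⟩
    ∣ (p ℚ.- q) ℚ.+ (q ℚ.- r) ∣      ≤⟨ ℚₚ.∣p+q∣≤∣p∣+∣q∣ (p ℚ.- q) (q ℚ.- r) ⟩
    ∣ p ℚ.- q ∣ ℚ.+ ∣ q ℚ.- r ∣      <⟨ ℚₚ.+-mono-< h k ⟩
    ½ ℚ.* ε ℚ.+ ½ ℚ.* ε              ≡⟨ halves ε ⟩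
    ε                                ∎
    where open +-*-Solver

module ≃ᴿ = IsEquivalence ≃ᴿ-isEquivalence

+ᴿ-cong : ∀ {x y u v} → x ≃ᴿ y → u ≃ᴿ v → x +ᴿ u ≃ᴿ y +ᴿ v
+ᴿ-cong {x} {y} {u} {v} x≃y u≃v ε ε>0 =
  pureℕ (λ n → close (seq x n) (seq u n) (seq y n) (seq v n))
    ⊛ x≃y (½ ℚ.* ε) (half-pos ε ε>0) ⊛ u≃v (½ ℚ.* ε) (half-pos ε ε>0)
  where
  open ℚₚ.≤-Reasoning
  close : ∀ a b c d → ∣ a ℚ.- c ∣ ℚ.< ½ ℚ.* ε → ∣ b ℚ.- d ∣ ℚ.< ½ ℚ.* ε →
          ∣ (a ℚ.+ b) ℚ.- (c ℚ.+ d) ∣ ℚ.< ε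
  close a b c d h k = begin-strict
    ∣ (a ℚ.+ b) ℚ.- (c ℚ.+ d) ∣      ≡⟨ cong ∣_∣ (+-split a b c d) ⟩
    ∣ (a ℚ.- c) ℚ.+ (b ℚ.- d) ∣      ≤⟨ ℚₚ.∣p+q∣≤∣p∣+∣q∣ (a ℚ.- c) (b ℚ.- d) ⟩
    ∣ a ℚ.- c ∣ ℚ.+ ∣ b ℚ.- d ∣      <⟨ ℚₚ.+-mono-< h k ⟩
    ½ ℚ.* ε ℚ.+ ½ ℚ.* ε              ≡⟨ halves ε ⟩
    ε                                ∎

*ᴿ-cong : ∀ {x y u v} → x ≃ᴿ y → u ≃ᴿ v → x *ᴿ u ≃ᴿ y *ᴿ v
*ᴿ-cong {x} {y} {u} {v} x≃y u≃v ε ε>0 =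
  -- Bounds are taken for x and v because `*-split` gives x u - y v = x (u - v) + v (x - y).
  let A , A>0 , x<A     = eventually-bounded {seq x} (cauchy x)
      B , B>0 , v<B     = eventually-bounded {seq v} (cauchy v)
      δ , δ>0 , [A+B]δ≡ε = scale (A ℚ.+ B) ε (ℚₚ.+-mono-< A>0 B>0) ε>0
  in pureℕ (λ n → *-close (seq x n) (seq u n) (seq y n) (seq v n) A B δ ε [A+B]δ≡ε δ>0)
       ⊛ x<A ⊛ v<B ⊛ x≃y δ δ>0 ⊛ u≃v δ δ>0

-- The algebraic laws hold termwise in ℚ and are lifted by `pointwise`; only the congruences rest on
-- estimates.
ℝ-isCommutativeSemiring : IsCommutativeSemiring _≃ᴿ_ _+ᴿ_ _*ᴿ_ (fromℚ 0ℚ) (fromℚ 1ℚ)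
ℝ-isCommutativeSemiring = Biased.isCommutativeSemiringˡ record
  { +-isCommutativeMonoid = commutativeMonoid _+ᴿ_ (fromℚ 0ℚ)
      (λ {x} {y} {u} {v} → +ᴿ-cong {x} {y} {u} {v})
      (λ x y z → pointwise {(x +ᴿ y) +ᴿ z} {x +ᴿ (y +ᴿ z)} λ n →
        ℚₚ.+-assoc (seq x n) (seq y n) (seq z n))
      (λ x → pointwise {fromℚ 0ℚ +ᴿ x} {x} λ n → ℚₚ.+-identityˡ (seq x n))
      (λ x y → pointwise {x +ᴿ y} {y +ᴿ x} λ n → ℚₚ.+-comm (seq x n) (seq y n))
  ; *-isCommutativeMonoid = commutativeMonoid _*ᴿ_ (fromℚ 1ℚ)
      (λ {x} {y} {u} {v} → *ᴿ-cong {x} {y} {u} {v})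
      (λ x y z → pointwise {(x *ᴿ y) *ᴿ z} {x *ᴿ (y *ᴿ z)} λ n →
        ℚₚ.*-assoc (seq x n) (seq y n) (seq z n))
      (λ x → pointwise {fromℚ 1ℚ *ᴿ x} {x} λ n → ℚₚ.*-identityˡ (seq x n))
      (λ x y → pointwise {x *ᴿ y} {y *ᴿ x} λ n → ℚₚ.*-comm (seq x n) (seq y n))
  ; distribʳ = λ x y z → pointwise {(y +ᴿ z) *ᴿ x} {y *ᴿ x +ᴿ z *ᴿ x} λ n →
      ℚₚ.*-distribʳ-+ (seq x n) (seq y n) (seq z n)
  ; zeroˡ = λ x → pointwise {fromℚ 0ℚ *ᴿ x} {fromℚ 0ℚ} λ n → ℚₚ.*-zeroˡ (seq x n)
  }
  where
  commutativeMonoid : ∀ (_∙_ : ℝ → ℝ → ℝ) ε →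
    (∀ {x y u v} → x ≃ᴿ y → u ≃ᴿ v → (x ∙ u) ≃ᴿ (y ∙ v)) →
    (∀ x y z → ((x ∙ y) ∙ z) ≃ᴿ (x ∙ (y ∙ z))) →
    (∀ x → (ε ∙ x) ≃ᴿ x) → (∀ x y → (x ∙ y) ≃ᴿ (y ∙ x)) →
    IsCommutativeMonoid _≃ᴿ_ _∙_ ε
  commutativeMonoid _∙_ ε ∙-cong assoc identityˡ comm =
    Biased.isCommutativeMonoidˡ record
      { isSemigroup = record
          { isMagma = record
              { isEquivalence = ≃ᴿ-isEquivalence
              ; ∙-cong        = λ {x} {y} {u} {v} → ∙-cong {x} {y} {u} {v} }
          ; assoc = assoc }
      ; identityˡ = identityˡ
      ; comm      = comm }

-- The order of the real numbers

<ᴿ-isStrictPartialOrder : IsStrictPartialOrder _≃ᴿ_ _<ᴿ_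
<ᴿ-isStrictPartialOrder = record
  { isEquivalence = ≃ᴿ-isEquivalence
  ; irrefl        = λ {x} {y} → irrefl x y
  ; trans         = λ {x} {y} {z} → <ᴿ-trans x y z
  ; <-resp-≈      = (λ {x} {y} {z} → respʳ x y z) , (λ {x} {y} {z} → respˡ x y z)
  }
  where
  open ℚₚ.≤-Reasoning

  irrefl : ∀ x y → x ≃ᴿ y → ¬ (x <ᴿ y)
  irrefl x y x≃y (ε , ε>0 , x<y) =
    -- Equality is invoked at the very ε that separates x from y, and the two estimates clash at
    -- index N.
    let N , false! = pureℕ (λ n x<y y-x<ε → ℚₚ.<-asym x<y (∣p-q∣<ε⇒p<q+ε (seq y n) (seq x n) ε y-x<ε))
                       ⊛ x<y ⊛ ≃ᴿ.sym {x} {y} x≃y ε ε>0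
    in false! N ℕₚ.≤-refl

  <ᴿ-trans : ∀ x y z → x <ᴿ y → y <ᴿ z → x <ᴿ z
  <ᴿ-trans x y z (ε , ε>0 , x<y) (δ , δ>0 , y<z) = ε , ε>0 ,
    (pureℕ (λ n x<y y<z → begin-strict
      seq x n ℚ.+ ε  <⟨ x<y ⟩
      seq y n        ≡⟨ ℚₚ.+-identityʳ (seq y n) ⟨
      seq y n ℚ.+ 0ℚ <⟨ ℚₚ.+-monoʳ-< (seq y n) δ>0 ⟩
      seq y n ℚ.+ δ  <⟨ y<z ⟩
      seq z n        ∎) ⊛ x<y ⊛ y<z)

  respʳ : ∀ x y z → y ≃ᴿ z → x <ᴿ y → x <ᴿ z
  respʳ x y z y≃z (ε , ε>0 , x<y) = ½ ℚ.* ε , half-pos ε ε>0 ,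
    (pureℕ (λ n x<y y-z<ε → <-halve (seq x n) (seq y n) (seq z n) ε x<y
                              (∣p-q∣<ε⇒p<q+ε (seq y n) (seq z n) (½ ℚ.* ε) y-z<ε))
      ⊛ x<y ⊛ y≃z (½ ℚ.* ε) (half-pos ε ε>0))

  respˡ : ∀ x y z → y ≃ᴿ z → y <ᴿ x → z <ᴿ x
  respˡ x y z y≃z (ε , ε>0 , y<x) = ½ ℚ.* ε , half-pos ε ε>0 ,
    (pureℕ (λ n y<x z-y<ε → begin-strict
      seq z n ℚ.+ ½ ℚ.* ε
        <⟨ ℚₚ.+-monoˡ-< (½ ℚ.* ε) (∣p-q∣<ε⇒p<q+ε (seq z n) (seq y n) (½ ℚ.* ε) z-y<ε) ⟩
      (seq y n ℚ.+ ½ ℚ.* ε) ℚ.+ ½ ℚ.* ε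
        ≡⟨ trans (ℚₚ.+-assoc (seq y n) _ _) (cong (seq y n ℚ.+_) (halves ε)) ⟩
      seq y n ℚ.+ ε
        <⟨ y<x ⟩
      seq x n ∎) ⊛ y<x ⊛ ≃ᴿ.sym {y} {z} y≃z (½ ℚ.* ε) (half-pos ε ε>0))

+ᴿ-monoˡ-< : ∀ {a b} c → a <ᴿ b → a +ᴿ c <ᴿ b +ᴿ c
+ᴿ-monoˡ-< {a} {b} c (ε , ε>0 , a<b) = ε , ε>0 ,
  (pureℕ (λ n a<b → subst (ℚ._< seq b n ℚ.+ seq c n) (swap (seq a n) ε (seq c n))
                      (ℚₚ.+-monoˡ-< (seq c n) a<b)) ⊛ a<b)
  where
  swap : ∀ a ε c → (a ℚ.+ ε) ℚ.+ c ≡ (a ℚ.+ c) ℚ.+ ε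
  swap = solve 3 (λ a e c → (a :+ e) :+ c := (a :+ c) :+ e) refl
    where open +-*-Solver

ℝ-directed : ∀ a b → Σ[ c ∈ ℝ ] (a <ᴿ c × b <ᴿ c)
ℝ-directed a b =
  let A , A>0 , a<A = eventually-bounded {seq a} (cauchy a)
      B , B>0 , b<B = eventually-bounded {seq b} (cauchy b)
  -- Each of the two bounds serves as the separation for the other number: a + B lies below A + B,
  -- and so does b + A.
  in fromℚ (A ℚ.+ B)
   , (B , B>0 , (pureℕ (λ n h → ℚₚ.+-monoˡ-< B (ℚₚ.≤-<-trans (p≤∣p∣ (seq a n)) h)) ⊛ a<A))
   , (A , A>0 , (pureℕ (λ n h → subst (seq b n ℚ.+ A ℚ.<_) (ℚₚ.+-comm B A)
                   (ℚₚ.+-monoˡ-< A (ℚₚ.≤-<-trans (p≤∣p∣ (seq b n)) h))) ⊛ b<B))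

gapᴿ : ℝ
gapᴿ = fromℚ ½

gapᴿ-< : ∀ {a b} → gapᴿ +ᴿ a <ᴿ b → a <ᴿ b
gapᴿ-< {a} {b} (ε , ε>0 , a<b) = ε , ε>0 ,
  (pureℕ (λ n → ℚₚ.<-trans (ℚₚ.+-monoˡ-< ε (subst (ℚ._< ½ ℚ.+ seq a n) (ℚₚ.+-identityˡ (seq a n))
                  (ℚₚ.+-monoˡ-< (seq a n) (ℚₚ.positive⁻¹ ½))))) ⊛ a<b)

-- As q exceeds p by more than ½, x q exceeds x p by more than x / 2, which has to outweigh ½ + a -
-- b. The latter is below C = A + B + ½, so x beyond 2 C suffices. It is the fixed ½, and not the
-- separation ε of p and q, that is multiplied by x, so the bound depends on neither p nor q.
ℝ-dominates : ∀ a b → Σ[ z ∈ ℝ ] (∀ x → z <ᴿ x → ∀ p q →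
  gapᴿ +ᴿ p <ᴿ q → gapᴿ +ᴿ (a +ᴿ x *ᴿ p) <ᴿ b +ᴿ x *ᴿ q)
ℝ-dominates a b =
  let A , A>0 , a<A = eventually-bounded {seq a} (cauchy a)
      B , B>0 , b<B = eventually-bounded {seq b} (cauchy b)
      C             = (A ℚ.+ B) ℚ.+ ½
      C>0           = ℚₚ.+-mono-< (ℚₚ.+-mono-< A>0 B>0) (ℚₚ.positive⁻¹ ½)
  in fromℚ (C ℚ.+ C) , λ { x (η , η>0 , z<x) p q (ε , ε>0 , p<q) →
       -- Since x is halved in the estimate, half of its excess η over 2 C survives.
       ½ ℚ.* η , half-pos η η>0 ,
       (pureℕ (λ n → bound A B (seq a n) (seq b n) (seq x n) (seq p n) (seq q n) η ε
                       (ℚₚ.+-mono-< (ℚₚ.+-mono-< C>0 C>0) η>0) ε>0)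
         ⊛ a<A ⊛ b<B ⊛ z<x ⊛ p<q) }
  where
  open ℚₚ.≤-Reasoning

  -- Half of 2 C + η splits exactly into the ½, A, B and ½ η that have to be paid for.
  collect : ∀ A B b xp η →
    ((½ ℚ.+ (A ℚ.+ xp)) ℚ.+ ½ ℚ.* η) ℚ.+ (B ℚ.+ b) ≡
    b ℚ.+ (xp ℚ.+ ((((A ℚ.+ B) ℚ.+ ½) ℚ.+ ((A ℚ.+ B) ℚ.+ ½)) ℚ.+ η) ℚ.* ½)
  collect = solve 5 (λ A B b xp e →
    ((con ½ :+ (A :+ xp)) :+ con ½ :* e) :+ (B :+ b) :=
    b :+ (xp :+ ((((A :+ B) :+ con ½) :+ ((A :+ B) :+ con ½)) :+ e) :* con ½)) refl
    where open +-*-Solver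

  factor : ∀ x p → x ℚ.* p ℚ.+ x ℚ.* ½ ≡ x ℚ.* (½ ℚ.+ p)
  factor = solve 2 (λ x p → x :* p :+ x :* con ½ := x :* (con ½ :+ p)) refl
    where open +-*-Solver

  bound : ∀ A B a b x p q η ε (let C = (A ℚ.+ B) ℚ.+ ½) →
    0ℚ ℚ.< (C ℚ.+ C) ℚ.+ η → 0ℚ ℚ.< ε →
    ∣ a ∣ ℚ.< A → ∣ b ∣ ℚ.< B → (C ℚ.+ C) ℚ.+ η ℚ.< x → (½ ℚ.+ p) ℚ.+ ε ℚ.< q →
    (½ ℚ.+ (a ℚ.+ x ℚ.* p)) ℚ.+ ½ ℚ.* η ℚ.< b ℚ.+ x ℚ.* q
  bound A B a b x p q η ε z>0 ε>0 a<A b<B z<x p<q = begin-strict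
    (½ ℚ.+ (a ℚ.+ x ℚ.* p)) ℚ.+ ½ ℚ.* η
      <⟨ ℚₚ.+-monoˡ-< (½ ℚ.* η) (ℚₚ.+-monoʳ-< ½
           (ℚₚ.+-monoˡ-< (x ℚ.* p) (ℚₚ.≤-<-trans (p≤∣p∣ a) a<A))) ⟩
    S
      ≡⟨ ℚₚ.+-identityʳ S ⟨
    S ℚ.+ 0ℚ
      <⟨ ℚₚ.+-monoʳ-< S (∣p∣<ε⇒0<ε+p b B b<B) ⟩
    S ℚ.+ (B ℚ.+ b)
      ≡⟨ collect A B b (x ℚ.* p) η ⟩
    b ℚ.+ (x ℚ.* p ℚ.+ ((C ℚ.+ C) ℚ.+ η) ℚ.* ½)
      <⟨ ℚₚ.+-monoʳ-< b (ℚₚ.+-monoʳ-< (x ℚ.* p) (ℚₚ.*-monoˡ-<-pos ½ z<x)) ⟩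
    b ℚ.+ (x ℚ.* p ℚ.+ x ℚ.* ½)
      ≡⟨ cong (b ℚ.+_) (factor x p) ⟩
    b ℚ.+ x ℚ.* (½ ℚ.+ p)
      <⟨ ℚₚ.+-monoʳ-< b (ℚₚ.*-monoʳ-<-pos x {{ℚ.positive (ℚₚ.<-trans z>0 z<x)}} ½+p<q) ⟩
    b ℚ.+ x ℚ.* q ∎
    where
    C = (A ℚ.+ B) ℚ.+ ½
    S = (½ ℚ.+ (A ℚ.+ x ℚ.* p)) ℚ.+ ½ ℚ.* η
    ½+p<q : ½ ℚ.+ p ℚ.< q
    ½+p<q = begin-strict
      ½ ℚ.+ p            ≡⟨ ℚₚ.+-identityʳ (½ ℚ.+ p) ⟨
      (½ ℚ.+ p) ℚ.+ 0ℚ   <⟨ ℚₚ.+-monoʳ-< (½ ℚ.+ p) ε>0 ⟩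
      (½ ℚ.+ p) ℚ.+ ε    <⟨ p<q ⟩
      q                  ∎

𝓡-axioms : Axioms 𝓡
𝓡-axioms = record
  { isCommutativeSemiring = ℝ-isCommutativeSemiring
  ; isStrictPartialOrder  = <ᴿ-isStrictPartialOrder
  ; +-monoˡ-<             = λ {a} {b} → +ᴿ-monoˡ-< {a} {b}
  ; directed              = ℝ-directed
  ; gap                   = gapᴿ
  -- The separation must stay strictly below 1 - ½; the resulting inequality of closed rationals is
  -- decided by computation.
  ; gap<1                 = ¼ , ℚₚ.positive⁻¹ ¼ , pureℕ (λ n → toWitness {a? = ½ ℚ.+ ¼ ℚₚ.<? 1ℚ} _)
  ; gap-<                 = λ {a} {b} → gapᴿ-< {a} {b}
  ; dominates             = ℝ-dominates
  }
  where ¼ = ½ ℚ.* ½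

-- Numerals in both structures and the transfer

module 𝓝-Correctness = Correctness 𝓝-axioms
module 𝓡-Correctness = Correctness 𝓡-axioms

ℕ-numeral : ∀ n → n ≡ 𝓝-Correctness.numeral n
ℕ-numeral zero    = refl
ℕ-numeral (suc n) = cong suc (ℕ-numeral n)

-- Division in ℚ normalises by a gcd, which does not compute for a variable n. Among unnormalised
-- rationals both sides are fractions with denominator 1, and cross-multiplication settles the
-- equality.
[1+n]/1≡1+n/1 : ∀ n → + suc n ℚ./ 1 ≡ 1ℚ ℚ.+ (+ n ℚ./ 1)
[1+n]/1≡1+n/1 n = ℚₚ.toℚᵘ-injective (begin
  ℚ.toℚᵘ (+ suc n ℚ./ 1)                 ≈⟨ ℚₚ.toℚᵘ-fromℚᵘ (ℚᵘ.mkℚᵘ (+ suc n) 0) ⟩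
  ℚᵘ.mkℚᵘ (+ suc n) 0                    ≈⟨ ℚᵘ.*≡* (cong (λ i → (+ 1 ℤ.+ i) ℤ.* + 1)
                                                     (sym (ℤₚ.*-identityʳ (+ n)))) ⟩
  ℚᵘ.1ℚᵘ ℚᵘ.+ ℚᵘ.mkℚᵘ (+ n) 0            ≈⟨ ℚᵘₚ.+-congʳ ℚᵘ.1ℚᵘ (ℚₚ.toℚᵘ-fromℚᵘ (ℚᵘ.mkℚᵘ (+ n) 0)) ⟨
  ℚᵘ.1ℚᵘ ℚᵘ.+ ℚ.toℚᵘ (+ n ℚ./ 1)         ≈⟨ ℚₚ.toℚᵘ-homo-+ 1ℚ (+ n ℚ./ 1) ⟨
  ℚ.toℚᵘ (1ℚ ℚ.+ (+ n ℚ./ 1))            ∎)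
  where open ℚᵘₚ.≃-Reasoning

seq-numeral : ∀ m n → seq (fromℕ m) n ≡ seq (𝓡-Correctness.numeral m) n
seq-numeral zero    n = refl
seq-numeral (suc m) n = trans ([1+n]/1≡1+n/1 m) (cong (1ℚ ℚ.+_) (seq-numeral m n))

reflects⇒⇔ : ∀ {A B : Set} {b} → Reflects A b → Reflects B b → A ⇔ B
reflects⇒⇔ (ofʸ a)  (ofʸ b)  = mk⇔ (λ _ → b) (λ _ → a)
reflects⇒⇔ (ofⁿ ¬a) (ofⁿ ¬b) = mk⇔ (λ a → contradiction a ¬a) (λ b → contradiction b ¬b)

theorem2p1 : ∀ (m : ℕ) (φ : 𝓕 m) (ns : Vec ℕ m) →
    (𝓝 ⊨ φ [ ns ]) ⇔ (𝓡 ⊨ φ [ map fromℕ ns ])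
-- At depth 0 the generic tuple is empty, and `decide 0 ns φ` refers to neither structure, so one
-- boolean reflects both truth values.
theorem2p1 m φ ns = reflects⇒⇔
  (𝓝-Correctness.decide-correct ns ns (λ i → ℕ-numeral (lookup ns i)) 0 φ)
  (𝓡-Correctness.decide-correct ns (map fromℕ ns) numerals 0 φ)
  where
  numerals : ∀ i → lookup (map fromℕ ns) i ≃ᴿ 𝓡-Correctness.numeral (lookup ns i)
  numerals i rewrite lookup-map i fromℕ ns =
    pointwise {fromℕ k} {𝓡-Correctness.numeral k} (seq-numeral k)
    where k = lookup ns i
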